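{- The length $L(n)$ of the Namer--Claimer game on $[n]$, with optimal play from both sides, is $\Theta(\log\log n)$ as $n\to\infty$. That is, there exist constants $c,C>0$ and $n_0$ such that $c\log\log n\le L(n)\le C\log\log n$ for all $n\ge n_0$.
   Context: Write $[n]=\{1,\ldots,n\}$. The Namer--Claimer game on $[n]$ ($n\ge 2$) is played as follows. Set $A_0=[n]$ (the unclaimed points). In round $i=1,2,\ldots$, Namer names a distance $d_i\in[n-1]$ (repetitions of earlier distances are allowed); then, knowing $d_i$, Claimer selects a set $C_i\subseteq A_{i-1}$ that is $d_i$-free, i.e. contains no two points $x,y$ with $|x-y|=d_i$; set $A_i=A_{i-1}\setminus C_i$. If $A_i=\emptyset$ the game ends and Claimer has won (in $i$ rounds); otherwise play continues to round $i+1$. Both players have full information about all previous moves. Claimer aims to minimise the number of rounds and Namer aims to maximise it. The length $L(n)$ of the game with optimal play is the least $k$ such that Claimer has a strategy guaranteeing that the game ends in at most $k$ rounds, whatever Namer does. -}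

module Defs where

open import Data.Empty using (⊥-elim)
open import Data.Fin using (Fin; toℕ)
import Data.Fin.Properties as Fin
open import Data.Fin.Subset using (Subset; _∈_; _⊆_; _─_; ∣_∣; ⊤; ⁅_⁆; Empty)
open import Data.Fin.Subset.Properties
  using (nonempty?; _⊆?_; _∈?_; anySubset?; ∣⊤∣≡n; x∈⁅y⁆⇒x≡y; x∈p⇒∣p-x∣<∣p∣)
open import Data.Nat
  using (ℕ; zero; suc; _*_; _^_; _∸_; _≤_; z≤n; s≤s; NonZero; ∣_-_∣; _≟_)
open import Data.Nat.Properties using (≤-trans; ≤-reflexive; ≤-pred; m*n≢0; ∣n-n∣≡0)
open import Data.Product using (Σ-syntax; ∃-syntax; _×_; _,_; proj₁; proj₂)
open import Function using (_∘_)
open import Relation.Binary.PropositionalEquality using (_≡_; _≢_; refl; sym; trans; subst)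
open import Relation.Nullary using (yes; no)
open import Relation.Nullary.Decidable using (_×-dec_; _→-dec_; ¬?; map′)
open import Relation.Unary using (Decidable)

-- The point i + 1 of [n] is represented by i : Fin n, and the distance
-- d + 1 in [n - 1] by d : Fin (n ∸ 1).

Distance : ℕ → Set
Distance n = Fin (n ∸ 1)

distance : ∀ {m} → Fin m → ℕ
distance d = suc (toℕ d)

Free : ∀ {n} → ℕ → Subset n → Set
Free d C = ∀ x y → x ∈ C → y ∈ C → ∣ toℕ x - toℕ y ∣ ≢ d

-- Strategy k A: the strategies of Claimer that, when A is the set of
-- unclaimed points, end the game within k further rounds.  Such a strategy is
-- a tree branching over Namer's choices, so Claimer's reply may depend on the
-- whole history of the game.

data Strategy {n : ℕ} : ℕ → Subset n → Set where
  over  : ∀ {k A} → Empty A → Strategy k A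
  reply : ∀ {k A} →
          ((d : Distance n) → ∃[ C ] C ⊆ A × Free (distance d) C × Strategy k (A ─ C)) →
          Strategy (suc k) A

ClaimerWinsWithin : ℕ → ℕ → Set
ClaimerWinsWithin n k = Strategy {n} k ⊤

IsLeast : (ℕ → Set) → ℕ → Set
IsLeast P k = P k × (∀ j → P j → k ≤ j)

-- A least number of rounds exists: winning within k rounds is decidable, and
-- Claimer wins within n rounds by claiming one point per round.

free? : ∀ {n} (d : ℕ) → Decidable (Free {n} d)
free? d C = Fin.all? λ x → Fin.all? λ y →
  (x ∈? C) →-dec ((y ∈? C) →-dec ¬? (∣ toℕ x - toℕ y ∣ ≟ d))

strategy? : ∀ {n} k → Decidable (Strategy {n} k)
strategy? k A with nonempty? A
strategy? k       A | no  A-empty = yes (over A-empty)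
strategy? zero    A | yes A-nonempty = no λ { (over A-empty) → A-empty A-nonempty }
strategy? (suc k) A | yes A-nonempty = map′ reply
  (λ { (over A-empty) → ⊥-elim (A-empty A-nonempty) ; (reply r) → r })
  (Fin.all? λ d → anySubset? λ C →
    (C ⊆? A) ×-dec (free? (distance d) C ×-dec strategy? k (A ─ C)))

singleton-free : ∀ {n} (d : Distance n) (x : Fin n) → Free (distance d) ⁅ x ⁆
singleton-free d x y z y∈ z∈ eq
  with refl ← x∈⁅y⁆⇒x≡y x y∈ | refl ← x∈⁅y⁆⇒x≡y x z∈
  with () ← trans (sym (∣n-n∣≡0 (toℕ x))) eq

one-by-one : ∀ {n} k (A : Subset n) → ∣ A ∣ ≤ k → Strategy k A
one-by-one k A ∣A∣≤k with nonempty? A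
one-by-one k       A ∣A∣≤k | no A-empty = over A-empty
one-by-one zero    A ∣A∣≤k | yes (x , x∈A)
  with () ← ≤-trans (x∈p⇒∣p-x∣<∣p∣ x∈A) ∣A∣≤k
one-by-one (suc k) A ∣A∣≤k | yes (x , x∈A) = reply λ d →
  ⁅ x ⁆ ,
  (λ y∈ → subst (_∈ A) (sym (x∈⁅y⁆⇒x≡y x y∈)) x∈A) ,
  singleton-free d x ,
  one-by-one k (A ─ ⁅ x ⁆) (≤-pred (≤-trans (x∈p⇒∣p-x∣<∣p∣ x∈A) ∣A∣≤k))

least : ∀ {P : ℕ → Set} → Decidable P → ∀ m → P m → ∃[ k ] IsLeast P k
least P? zero    p = zero , p , λ _ _ → z≤n
least P? (suc m) p with P? zero
... | yes p₀ = zero , p₀ , λ _ _ → z≤n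
... | no ¬p₀ with k , pₖ , min ← least (P? ∘ suc) m p =
  suc k , pₖ , λ { zero p₀ → ⊥-elim (¬p₀ p₀) ; (suc j) pⱼ → s≤s (min j pⱼ) }

∃-length : ∀ n → ∃[ k ] IsLeast (ClaimerWinsWithin n) k
∃-length n =
  least (λ k → strategy? k ⊤) n (one-by-one n ⊤ (≤-reflexive (∣⊤∣≡n n)))

L : ℕ → ℕ
L n = proj₁ (∃-length n)

L-isLeast : ∀ n → IsLeast (ClaimerWinsWithin n) (L n)
L-isLeast n = proj₂ (∃-length n)

-- A nonnegative real x, given by its comparisons with the nonnegative
-- fractions: Lower a b means a/b ≤ x and Upper a b means x ≤ a/b.

record Cut : Set₁ where
  field
    Lower Upper : (a b : ℕ) → .{{NonZero b}} → Set

open Cut public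

fromℕ : ℕ → Cut
fromℕ n .Lower a b = a ≤ n * b
fromℕ n .Upper a b = n * b ≤ a

-- The logarithm to base 2 of a real x ≥ 1.  The condition p/q ≤ log₂ x says
-- 2^(p/q) ≤ x, i.e. every fraction a/b ≤ 2^(p/q) satisfies a/b ≤ x; and
-- a/b ≤ 2^(p/q) says a^q ≤ 2^p b^q.  Dually for log₂ x ≤ p/q.
-- In a Θ-bound on log log the base of the logarithm is immaterial.

log₂ : Cut → Cut
log₂ x .Lower p q = ∀ a b → .{{_ : NonZero b}} → a ^ q ≤ 2 ^ p * b ^ q → Lower x a b
log₂ x .Upper p q = ∀ a b → .{{_ : NonZero b}} → 2 ^ p * b ^ q ≤ a ^ q → Upper x a b

-- For Θ-bounds, positive rational constants are as good as positive real ones.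

record ℚ⁺ : Set where
  constructor mkℚ⁺
  field
    num den     : ℕ
    .{{num≢0}} : NonZero num
    .{{den≢0}} : NonZero den

infixr 7 _·_

-- a/b ≤ (u/v) x  iff  (a v)/(b u) ≤ x.

_·_ : ℚ⁺ → Cut → Cut
(mkℚ⁺ u v · x) .Lower a b = Lower x (a * v) (b * u) {{m*n≢0 b u}}
(mkℚ⁺ u v · x) .Upper a b = Upper x (a * v) (b * u) {{m*n≢0 b u}}

infix 4 _ℕ≤_ _≤ℕ_

_ℕ≤_ : ℕ → Cut → Set
m ℕ≤ x = Lower x m 1

_≤ℕ_ : Cut → ℕ → Set
x ≤ℕ m = Upper x m 1

{-# OPTIONS --safe #-}

-- Upper bound: let Claimer always claim greedily, taking x iff x is unclaimed
-- and x + d is not taken in the same round.  If W survives such a round, then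
-- W + d lies in the set just claimed, so W ∪ (W + d) consists of 2∣W∣ points
-- that were unclaimed before the round.  Hence a survivor of k greedy rounds
-- yields a k-dimensional cube of 2^k distinct points that was unclaimed at the
-- start.  There are at most n^(k+1) cubes, and a random set avoiding the first
-- distance meets all those with 2^k points as soon as 2^k is a large multiple
-- of k log n; Claimer opens with such a set.
--
-- Lower bound: for some distance d, at least ∣A∣(∣A∣ - 1) / 2(n - 1) pairs in A
-- are d apart; each keeps an unclaimed point, so Namer can keep the density
-- after a round above a constant times its square.

module Submission where

open import Defs
open import Data.Bool using (Bool; true; false; not; _∧_; _∨_; if_then_else_)
open import Data.Empty using (⊥; ⊥-elim)
open import Data.Fin using (Fin; zero; suc; toℕ)
open import Data.Fin.Subset using (Subset; _∈_; _⊆_; _─_; ∣_∣; ⊤; ⁅_⁆)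
open import Data.Fin.Subset.Properties
  using (∣⊤∣≡n; ∣⊥∣≡0; ∣⁅x⁆∣≡1; ∈⊤; x∈⁅y⁆⇒x≡y; drop-∷-⊆; ∣p∣≤n; Empty-unique)
open import Data.List using (List; []; _∷_; length; map; allFin; filter; cartesianProductWith)
open import Data.List.Membership.Propositional using () renaming (_∈_ to _∈ˡ_)
open import Data.List.Membership.Propositional.Properties
  using (∈-cartesianProductWith⁺; ∈-map⁺; ∈-allFin; ∈-filter⁺)
open import Data.List.Properties using (length-map; length-tabulate; length-filter; length-++)
open import Data.List.Relation.Unary.All as All using (All; []; _∷_)
open import Data.List.Relation.Unary.All.Properties using (all-filter)
open import Data.Nat
open import Data.Nat.ListAction using (sum)
open import Data.Nat.Properties
open import Data.Nat.Tactic.RingSolver using (solve-∀)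
open import Data.Product using (Σ-syntax; ∃-syntax; _×_; _,_; proj₁; proj₂)
open import Data.Sum using (_⊎_; inj₁; inj₂)
open import Data.Vec using (Vec; []; _∷_; _∷ʳ_; replicate; here; there)
open import Function using (_∘_)
open import Relation.Binary.PropositionalEquality
  using (_≡_; refl; sym; trans; cong; cong₂; subst; module ≡-Reasoning)
open import Relation.Nullary using (yes; no; ¬_)

import Data.Unit as Unit
import Algebra.Properties.Semiring.Sum +-*-semiring as Fin∑

-- Subsets indexed by natural numbers, with nothing outside the range

infix 8 _!_

_!_ : ∀ {n} → Vec Bool n → ℕ → Bool
[]      ! _     = false
(a ∷ A) ! zero  = a
(a ∷ A) ! suc j = A ! j

∈⇒! : ∀ {n} {A : Subset n} {x} → x ∈ A → A ! toℕ x ≡ true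
∈⇒! here      = refl
∈⇒! (there p) = ∈⇒! p

!⇒∈ : ∀ {n} (A : Subset n) j → A ! j ≡ true → ∃[ x ] toℕ x ≡ j × x ∈ A
!⇒∈ (a ∷ A) zero    refl = zero , refl , here
!⇒∈ (a ∷ A) (suc j) eq with x , refl , x∈A ← !⇒∈ A j eq = suc x , refl , there x∈A

!-mono : ∀ {n} {A B : Subset n} → A ⊆ B → ∀ j → A ! j ≡ true → B ! j ≡ true
!-mono {A = A} A⊆B j eq with x , refl , x∈A ← !⇒∈ A j eq = ∈⇒! (A⊆B x∈A)

!-─ : ∀ {n} (A C : Subset n) j → A ! j ≡ true → C ! j ≡ false → (A ─ C) ! j ≡ true
!-─ (a ∷ A) (false ∷ C) zero    p q = p
!-─ (a ∷ A) (c     ∷ C) (suc j) p q = !-─ A C j p q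

shift-free⇒Free : ∀ {n} (C : Subset n) e →
  (∀ j → C ! j ≡ true → C ! (j + suc e) ≡ true → ⊥) → Free (suc e) C
shift-free⇒Free C e free x y x∈C y∈C eq with ≤-total (toℕ x) (toℕ y)
... | inj₁ x≤y = free (toℕ x) (∈⇒! x∈C) (subst (λ j → C ! j ≡ true) y≡ (∈⇒! y∈C))
  where
  y≡ : toℕ y ≡ toℕ x + suc e
  y≡ = trans (sym (m+[n∸m]≡n x≤y)) (cong (toℕ x +_) (trans (sym (m≤n⇒∣m-n∣≡n∸m x≤y)) eq))
... | inj₂ y≤x = free (toℕ y) (∈⇒! y∈C) (subst (λ j → C ! j ≡ true) x≡ (∈⇒! x∈C))
  where
  x≡ : toℕ x ≡ toℕ y + suc e
  x≡ = trans (sym (m+[n∸m]≡n y≤x)) (cong (toℕ y +_) (trans (sym (m≤n⇒∣n-m∣≡n∸m y≤x)) eq))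

Free⇒shift-free : ∀ {n} (C : Subset n) e → Free (suc e) C →
  ∀ j → C ! j ≡ true → C ! (j + suc e) ≡ true → ⊥
Free⇒shift-free C e free j p q
  with x , refl , x∈C ← !⇒∈ C j p | y , eq , y∈C ← !⇒∈ C _ q =
  free x y x∈C y∈C (trans (cong ∣ toℕ x -_∣ eq) (∣m-m+n∣≡n (toℕ x) (suc e)))

-- Greedy claims and cubes

-- The parameter e of shift-related functions stands for the distance e + 1.
greedy : ∀ {n} → ℕ → Subset n → Subset n
greedy e []      = []
greedy e (a ∷ A) = (a ∧ not (greedy e A ! e)) ∷ greedy e A

greedy-⊆ : ∀ {n} e (A : Subset n) → greedy e A ⊆ A
greedy-⊆ e (true ∷ A) {zero}  p         = here
greedy-⊆ e (a ∷ A)    {suc x} (there p) = there (greedy-⊆ e A p)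

greedy-shift-free : ∀ {n} e (A : Subset n) j →
  greedy e A ! j ≡ true → greedy e A ! (j + suc e) ≡ true → ⊥
greedy-shift-free e (true ∷ A) zero    p q with true ← greedy e A ! e | () ← p
greedy-shift-free e (a ∷ A)    (suc j) p q = greedy-shift-free e A j p q

greedy-free : ∀ {n} e (A : Subset n) → Free (suc e) (greedy e A)
greedy-free e A = shift-free⇒Free _ e (greedy-shift-free e A)

insertIf : ∀ {n} → ℕ → Bool → Subset n → Subset n
insertIf j       b []      = []
insertIf zero    b (a ∷ A) = (b ∨ a) ∷ A
insertIf (suc j) b (a ∷ A) = a ∷ insertIf j b A

-- W ∪ (W + (e + 1)), where points shifted out of range are lost.
spread : ∀ {n} → ℕ → Subset n → Subset n
spread e []      = []
spread e (w ∷ W) = w ∷ insertIf e w (spread e W)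

insertIf-⊆ : ∀ {n} j b {A B : Subset n} → A ⊆ B → (b ≡ true → B ! j ≡ true) →
             insertIf j b A ⊆ B
insertIf-⊆ zero    true  {a ∷ A} {b ∷ B} A⊆B h {zero}  here with refl ← h refl = here
insertIf-⊆ zero    false {a ∷ A} {b ∷ B} A⊆B h         p         = A⊆B p
insertIf-⊆ zero    true  {a ∷ A} {b ∷ B} A⊆B h {suc x} (there p) = A⊆B (there p)
insertIf-⊆ (suc j) c     {a ∷ A} {b ∷ B} A⊆B h {zero}  here      = A⊆B here
insertIf-⊆ (suc j) c     {a ∷ A} {b ∷ B} A⊆B h {suc x} (there p) =
  there (insertIf-⊆ j c (drop-∷-⊆ A⊆B) h p)

-- `insertIf` drops an index out of range, so `B` serves as the witness that `j` is in range; the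
-- point then really is new.
∣insertIf∣ : ∀ {n} j (A B : Subset n) → B ! j ≡ true → A ! j ≡ false →
           ∣ insertIf j true A ∣ ≡ suc ∣ A ∣
∣insertIf∣ zero    (false ∷ A) (b ∷ B) p q = refl
∣insertIf∣ (suc j) (true  ∷ A) (b ∷ B) p q = cong suc (∣insertIf∣ j A B p q)
∣insertIf∣ (suc j) (false ∷ A) (b ∷ B) p q = ∣insertIf∣ j A B p q

insertIf-false : ∀ {n} j (A : Subset n) → insertIf j false A ≡ A
insertIf-false j       []      = refl
insertIf-false zero    (a ∷ A) = refl
insertIf-false (suc j) (a ∷ A) = cong (a ∷_) (insertIf-false j A)

insertIf-! : ∀ {n} i j b (A : Subset n) → i < j → insertIf j b A ! i ≡ A ! i
insertIf-! i       j       b []      i<j       = refl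
insertIf-! zero    (suc j) b (a ∷ A) i<j       = refl
insertIf-! (suc i) (suc j) b (a ∷ A) (s≤s i<j) = insertIf-! i j b A i<j

-- Shifted points land at index `e + 1` or later, so they cannot disturb the indices up to `e`.
spread-! : ∀ {n} i e (W : Subset n) → i ≤ e → spread e W ! i ≡ W ! i
spread-! i       e []      i≤e = refl
spread-! zero    e (w ∷ W) i≤e = refl
spread-! (suc i) e (w ∷ W) i<e = trans (insertIf-! i e w (spread e W) i<e) (spread-! i e W (<⇒≤ i<e))

⊆─⇒! : ∀ {n} (A C W : Subset n) → W ⊆ A ─ C → ∀ j → C ! j ≡ true → W ! j ≡ false
⊆─⇒! A C W W⊆ j p with W ! j in eq
... | false = refl
... | true  = ⊥-elim (disjoint A C j (!-mono W⊆ j eq) p)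
  where
  disjoint : ∀ {n} (A C : Subset n) j → (A ─ C) ! j ≡ true → C ! j ≡ true → ⊥
  disjoint (a ∷ A) (true ∷ C) zero    ()
  disjoint (a ∷ A) (c ∷ C)    (suc j) p q = disjoint A C j p q

-- Greedy play passes over a point of the set only because the point `e + 1` further on, at index
-- `e` of the tail, is claimed.
unclaimed-head : ∀ {n} e a (A W : Subset n) → true ∷ W ⊆ (a ∷ A) ─ greedy e (a ∷ A) →
                 a ≡ true × greedy e A ! e ≡ true
unclaimed-head e a A W W⊆ with a | greedy e A ! e | W⊆ here
... | true | true | _ = refl , refl

spread-⊆ : ∀ {n} e (A W : Subset n) → W ⊆ A ─ greedy e A → spread e W ⊆ A
spread-⊆ e (a ∷ A) (true ∷ W) W⊆ here with refl , _ ← unclaimed-head e a A W W⊆ = here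
spread-⊆ e (a ∷ A) (w ∷ W)    W⊆ (there p) =
  there (insertIf-⊆ e w (spread-⊆ e A W (drop-∷-⊆ W⊆)) shifted p)
  where
  shifted : w ≡ true → A ! e ≡ true
  shifted refl = !-mono (greedy-⊆ e A) e (proj₂ (unclaimed-head e a A W W⊆))

-- Every shifted point is a claimed point: it is therefore in range, so not lost, and outside `W`,
-- so not counted twice.
∣spread∣ : ∀ {n} e (A W : Subset n) → W ⊆ A ─ greedy e A → ∣ spread e W ∣ ≡ 2 * ∣ W ∣
∣spread∣ e []      []          W⊆ = refl
∣spread∣ e (a ∷ A) (false ∷ W) W⊆ =
  trans (cong ∣_∣ (insertIf-false e (spread e W))) (∣spread∣ e A W (drop-∷-⊆ W⊆))
∣spread∣ e (a ∷ A) (true ∷ W)  W⊆ = begin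
  suc ∣ insertIf e true (spread e W) ∣ ≡⟨ cong suc (∣insertIf∣ e (spread e W) (greedy e A) claimed new) ⟩
  2 + ∣ spread e W ∣                   ≡⟨ cong (2 +_) (∣spread∣ e A W (drop-∷-⊆ W⊆)) ⟩
  2 + 2 * ∣ W ∣                        ≡⟨ *-suc 2 ∣ W ∣ ⟨
  2 * suc ∣ W ∣                        ∎
  where
  open ≡-Reasoning
  claimed : greedy e A ! e ≡ true
  claimed = proj₂ (unclaimed-head e a A W W⊆)
  new : spread e W ! e ≡ false
  new = trans (spread-! e e W ≤-refl) (⊆─⇒! A _ W (drop-∷-⊆ W⊆) e claimed)

-- Degenerate cubes, with coinciding points or points shifted out of range, are listed as well; this
-- keeps the count simple but allows sizes below `2 ^ k`.
cubes : ∀ n → ℕ → List (Subset n)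
cubes n zero    = map ⁅_⁆ (allFin n)
cubes n (suc k) = cartesianProductWith (spread ∘ toℕ) (allFin (n ∸ 1)) (cubes n k)

length-cartesianProductWith : ∀ {A B C : Set} (f : A → B → C) xs ys →
  length (cartesianProductWith f xs ys) ≡ length xs * length ys
length-cartesianProductWith f []       ys = refl
length-cartesianProductWith f (x ∷ xs) ys = trans (length-++ (map (f x) ys))
  (cong₂ _+_ (length-map (f x) ys) (length-cartesianProductWith f xs ys))

length-allFin : ∀ n → length (allFin n) ≡ n
length-allFin n = length-tabulate {n = n} (λ x → x)

length-cubes : ∀ n k → length (cubes n k) ≤ n ^ suc k
length-cubes n zero    = ≤-reflexive
  (trans (length-map ⁅_⁆ (allFin n)) (trans (length-allFin n) (sym (*-identityʳ n))))
length-cubes n (suc k) = begin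
  length (cubes n (suc k))                    ≡⟨ length-cartesianProductWith _ (allFin (n ∸ 1)) _ ⟩
  length (allFin (n ∸ 1)) * length (cubes n k) ≡⟨ cong (_* length (cubes n k)) (length-allFin (n ∸ 1)) ⟩
  (n ∸ 1) * length (cubes n k)                ≤⟨ *-mono-≤ (m∸n≤m n 1) (length-cubes n k) ⟩
  n * n ^ suc k                               ∎
  where open ≤-Reasoning

-- A cube surviving the round would spread to a cube of one dimension more inside `A`, so the
-- hypothesis descends; in dimension 0 it excludes all single points.
greedy-wins : ∀ {n} k (A : Subset n) →
  (∀ W → W ∈ˡ cubes n k → ∣ W ∣ ≡ 2 ^ k → ¬ W ⊆ A) → Strategy k A
greedy-wins zero A no-cube = over λ { (x , x∈A) →
  no-cube ⁅ x ⁆ (∈-map⁺ ⁅_⁆ (∈-allFin x)) (∣⁅x⁆∣≡1 x)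
    λ y∈ → subst (_∈ A) (sym (x∈⁅y⁆⇒x≡y x y∈)) x∈A }
greedy-wins (suc k) A no-cube = reply λ d → let e = toℕ d in
  greedy e A , greedy-⊆ e A , greedy-free e A ,
  greedy-wins k (A ─ greedy e A) λ W W∈ ∣W∣ W⊆ →
    no-cube (spread e W) (∈-cartesianProductWith⁺ (spread ∘ toℕ) (∈-allFin d) W∈)
      (trans (∣spread∣ e A W W⊆) (cong (2 *_) ∣W∣)) (spread-⊆ e A W W⊆)

-- The opening move

-- A set is chosen point by point, in increasing order.  The queue holds the
-- choices at the last e + 1 points, oldest first: if its head was chosen, then
-- the next point must not be.
Paced : ∀ {e n} → Vec Bool (suc e) → Subset n → Set
Paced Q       []      = Unit.⊤
Paced (q ∷ Q) (c ∷ C) = (q ∧ c ≡ false) × Paced (Q ∷ʳ c) C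

∷ʳ-! : ∀ {n} (Q : Vec Bool n) c i → Q ! i ≡ true → (Q ∷ʳ c) ! i ≡ true
∷ʳ-! (q ∷ Q) c zero    p = p
∷ʳ-! (q ∷ Q) c (suc i) p = ∷ʳ-! Q c i p

∷ʳ-!-last : ∀ {n} (Q : Vec Bool n) c → (Q ∷ʳ c) ! n ≡ c
∷ʳ-!-last []      c = refl
∷ʳ-!-last (q ∷ Q) c = ∷ʳ-!-last Q c

-- Entry `i` of the queue reaches its head exactly when point `i` is decided.
Paced-queue : ∀ {e n} (Q : Vec Bool (suc e)) (C : Subset n) → Paced Q C →
              ∀ i → Q ! i ≡ true → C ! i ≡ true → ⊥
Paced-queue (true ∷ Q) (true ∷ C) (() , _)    zero    _ _
Paced-queue (q ∷ Q)    (c ∷ C)    (_ , paced) (suc i) p r =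
  Paced-queue (Q ∷ʳ c) C paced i (∷ʳ-! Q c i p) r

Paced-shift-free : ∀ {e n} (Q : Vec Bool (suc e)) (C : Subset n) → Paced Q C →
                   ∀ j → C ! j ≡ true → C ! (j + suc e) ≡ true → ⊥
Paced-shift-free {e} (q ∷ Q) (c ∷ C) (_ , paced) zero    p r =
  Paced-queue (Q ∷ʳ c) C paced e (trans (∷ʳ-!-last Q c) p) r
Paced-shift-free     (q ∷ Q) (c ∷ C) (_ , paced) (suc j) p r =
  Paced-shift-free (Q ∷ʳ c) C paced j p r

-- 4^n times an upper bound for the conditional probability that S is missed
-- when the remaining choices are made by fair coins wherever the queue permits:
-- a point is missed with probability 1 or 1/2 if its predecessor at the given
-- distance was chosen or not, and this is bounded by 3/4 while still unknown.
weight : ∀ {m n} → Vec Bool m → Subset n → ℕ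
weight Q       []      = 1
weight []      (s ∷ S) = (if s then 3 else 4) * weight [] S
weight (q ∷ Q) (s ∷ S) = (if s then (if q then 4 else 2) else 4) * weight Q S

weight-∷ʳ-false : ∀ {m n} (Q : Vec Bool m) (S : Subset n) → weight (Q ∷ʳ false) S ≤ weight Q S
weight-∷ʳ-false []      []          = ≤-refl
weight-∷ʳ-false (q ∷ Q) []          = ≤-refl
weight-∷ʳ-false []      (true ∷ S)  = *-monoˡ-≤ (weight [] S) (n≤1+n 2)
weight-∷ʳ-false []      (false ∷ S) = ≤-refl
weight-∷ʳ-false (q ∷ Q) (s ∷ S)     =
  *-monoʳ-≤ (if s then (if q then 4 else 2) else 4) (weight-∷ʳ-false Q S)

-- The factor 3 for an unknown predecessor is the mean of the factors 4 and 2 for a known one, so a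
-- fair coin does not raise the expected weight.
weight-∷ʳ : ∀ {m n} (Q : Vec Bool m) (S : Subset n) →
            weight (Q ∷ʳ true) S + weight (Q ∷ʳ false) S ≤ 2 * weight Q S
weight-∷ʳ []      []          = ≤-refl
weight-∷ʳ (q ∷ Q) []          = ≤-refl
weight-∷ʳ []      (true ∷ S)  = ≤-reflexive (eq (weight [] S))
  where
  eq : ∀ w → 4 * w + 2 * w ≡ 2 * (3 * w)
  eq = solve-∀
weight-∷ʳ []      (false ∷ S) = ≤-reflexive (eq (weight [] S))
  where
  eq : ∀ w → 4 * w + 4 * w ≡ 2 * (4 * w)
  eq = solve-∀
weight-∷ʳ (q ∷ Q) (s ∷ S)     = begin
  f * weight (Q ∷ʳ true) S + f * weight (Q ∷ʳ false) S ≡⟨ *-distribˡ-+ f _ _ ⟨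
  f * (weight (Q ∷ʳ true) S + weight (Q ∷ʳ false) S)   ≤⟨ *-monoʳ-≤ f (weight-∷ʳ Q S) ⟩
  f * (2 * weight Q S)                                 ≡⟨ eq f (weight Q S) ⟩
  2 * (f * weight Q S)                                 ∎
  where
  open ≤-Reasoning
  f : ℕ
  f = if s then (if q then 4 else 2) else 4
  eq : ∀ f w → f * (2 * w) ≡ 2 * (f * w)
  eq = solve-∀

weight-false : ∀ m {n} s (S : Subset n) → weight (replicate m false) (s ∷ S) ≤
               (if s then 3 else 4) * weight (replicate (pred m) false) S
weight-false zero    s     S = ≤-refl
weight-false (suc m) true  S = *-monoˡ-≤ (weight (replicate m false) S) (n≤1+n 2)
weight-false (suc m) false S = ≤-refl

-- Each point of `S` is missed with probability at most 3/4; under the `false` entries of the queue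
-- it is even 1/2.
weight-empty-queue : ∀ m {n} (S : Subset n) →
  weight (replicate m false) S * 4 ^ ∣ S ∣ ≤ 3 ^ ∣ S ∣ * 4 ^ n
weight-empty-queue m {zero} []          = ≤-refl
weight-empty-queue m {suc n} (true ∷ S)  = begin
  weight (replicate m false) (true ∷ S) * (4 * 4 ^ ∣ S ∣) ≤⟨ *-monoˡ-≤ _ (weight-false m true S) ⟩
  3 * w * (4 * 4 ^ ∣ S ∣)                                 ≡⟨ eq w (4 ^ ∣ S ∣) ⟩
  12 * (w * 4 ^ ∣ S ∣)                                    ≤⟨ *-monoʳ-≤ 12 (weight-empty-queue (pred m) S) ⟩
  12 * (3 ^ ∣ S ∣ * 4 ^ n)                                    ≡⟨ eq (3 ^ ∣ S ∣) (4 ^ n) ⟨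
  3 * 3 ^ ∣ S ∣ * (4 * 4 ^ n)                                 ∎
  where
  open ≤-Reasoning
  w : ℕ
  w = weight (replicate (pred m) false) S
  eq : ∀ w x → 3 * w * (4 * x) ≡ 12 * (w * x)
  eq = solve-∀
weight-empty-queue m {suc n} (false ∷ S) = begin
  weight (replicate m false) (false ∷ S) * 4 ^ ∣ S ∣ ≤⟨ *-monoˡ-≤ _ (weight-false m false S) ⟩
  4 * w * 4 ^ ∣ S ∣                                  ≡⟨ *-assoc 4 w _ ⟩
  4 * (w * 4 ^ ∣ S ∣)                                ≤⟨ *-monoʳ-≤ 4 (weight-empty-queue (pred m) S) ⟩
  4 * (3 ^ ∣ S ∣ * 4 ^ n)                                ≡⟨ eq (3 ^ ∣ S ∣) _ ⟩
  3 ^ ∣ S ∣ * (4 * 4 ^ n)                                ∎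
  where
  open ≤-Reasoning
  w : ℕ
  w = weight (replicate (pred m) false) S
  eq : ∀ w x → 4 * (w * x) ≡ w * (4 * x)
  eq = solve-∀

-- Derandomised choice of a transversal

totalWeight : ∀ {m n} → Vec Bool m → List (Subset n) → ℕ
totalWeight Q F = sum (map (weight Q) F)

-- What remains to be met after the choice c at the first point.
unmet : ∀ {n} → Bool → List (Subset (suc n)) → List (Subset n)
unmet c []            = []
unmet c ((s ∷ S) ∷ F) = if s ∧ c then unmet c F else S ∷ unmet c F

Meets : ∀ {n} → Subset n → Subset n → Set
Meets C S = ∃[ x ] x ∈ C × x ∈ S

meets-∷ : ∀ {n} c s {C S : Subset n} → Meets C S → Meets (c ∷ C) (s ∷ S)
meets-∷ c s (x , x∈C , x∈S) = suc x , there x∈C , there x∈S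

unmet-all : ∀ {n} c (C : Subset n) F → All (Meets C) (unmet c F) → All (Meets (c ∷ C)) F
unmet-all c     C []                ms       = []
unmet-all true  C ((true  ∷ S) ∷ F) ms       = (zero , here , here) ∷ unmet-all true C F ms
unmet-all true  C ((false ∷ S) ∷ F) (m ∷ ms) = meets-∷ true false m ∷ unmet-all true C F ms
unmet-all false C ((true  ∷ S) ∷ F) (m ∷ ms) = meets-∷ false true m ∷ unmet-all false C F ms
unmet-all false C ((false ∷ S) ∷ F) (m ∷ ms) = meets-∷ false false m ∷ unmet-all false C F ms

-- A forbidden point is missed with certainty, so it contributes the full factor 4 to every set, and
-- the appended `false` raises no weight.
forced-step : ∀ {e n} (Q : Vec Bool e) (F : List (Subset (suc n))) →
  4 * totalWeight (Q ∷ʳ false) (unmet false F) ≤ totalWeight (true ∷ Q) F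
forced-step Q []            = z≤n
forced-step Q ((true  ∷ S) ∷ F) =
  ≤-trans (≤-reflexive (*-distribˡ-+ 4 (weight (Q ∷ʳ false) S) _))
    (+-mono-≤ (*-monoʳ-≤ 4 (weight-∷ʳ-false Q S)) (forced-step Q F))
forced-step Q ((false ∷ S) ∷ F) =
  ≤-trans (≤-reflexive (*-distribˡ-+ 4 (weight (Q ∷ʳ false) S) _))
    (+-mono-≤ (*-monoʳ-≤ 4 (weight-∷ʳ-false Q S)) (forced-step Q F))

-- A set containing the point survives in one of the two branches only, which accounts for its
-- factor 2; any other set survives in both and is handled by `weight-∷ʳ`.
free-step : ∀ {e n} (Q : Vec Bool e) (F : List (Subset (suc n))) →
  2 * (totalWeight (Q ∷ʳ true) (unmet true F) + totalWeight (Q ∷ʳ false) (unmet false F))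
    ≤ totalWeight (false ∷ Q) F
free-step Q []                = z≤n
free-step Q ((true ∷ S) ∷ F)  = begin
  2 * (t + (w₀ + f))     ≡⟨ eq t w₀ f ⟩
  2 * w₀ + 2 * (t + f)   ≤⟨ +-mono-≤ (*-monoʳ-≤ 2 (weight-∷ʳ-false Q S)) (free-step Q F) ⟩
  2 * weight Q S + totalWeight (false ∷ Q) F ∎
  where
  open ≤-Reasoning
  t w₀ f : ℕ
  t  = totalWeight (Q ∷ʳ true) (unmet true F)
  f  = totalWeight (Q ∷ʳ false) (unmet false F)
  w₀ = weight (Q ∷ʳ false) S
  eq : ∀ t w f → 2 * (t + (w + f)) ≡ 2 * w + 2 * (t + f)
  eq = solve-∀
free-step Q ((false ∷ S) ∷ F) = begin
  2 * ((w₁ + t) + (w₀ + f))     ≡⟨ eq t w₁ w₀ f ⟩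
  2 * (w₁ + w₀) + 2 * (t + f)   ≤⟨ +-mono-≤ (*-monoʳ-≤ 2 (weight-∷ʳ Q S)) (free-step Q F) ⟩
  2 * (2 * weight Q S) + totalWeight (false ∷ Q) F ≡⟨ cong (_+ totalWeight (false ∷ Q) F) (*-assoc 2 2 (weight Q S)) ⟨
  4 * weight Q S + totalWeight (false ∷ Q) F ∎
  where
  open ≤-Reasoning
  t w₁ w₀ f : ℕ
  t  = totalWeight (Q ∷ʳ true) (unmet true F)
  f  = totalWeight (Q ∷ʳ false) (unmet false F)
  w₁ = weight (Q ∷ʳ true) S
  w₀ = weight (Q ∷ʳ false) S
  eq : ∀ t v w f → 2 * ((v + t) + (w + f)) ≡ 2 * (v + w) + 2 * (t + f)
  eq = solve-∀

-- The method of conditional expectations.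
paced-transversal : ∀ {e} n (Q : Vec Bool (suc e)) (F : List (Subset n)) →
  totalWeight Q F < 4 ^ n → ∃[ C ] Paced Q C × All (Meets C) F
paced-transversal zero    Q           []      lt = [] , Unit.tt , []
-- With no points left an unmet set weighs 1, so a total below `4 ^ 0` leaves none.
paced-transversal zero    Q           ([] ∷ F) (s≤s ())
paced-transversal (suc n) (true ∷ Q)  F       lt
  with C , paced , ms ← paced-transversal n (Q ∷ʳ false) (unmet false F)
         (*-cancelˡ-< 4 _ _ (≤-<-trans (forced-step Q F) lt)) =
  false ∷ C , (refl , paced) , unmet-all false C F ms
paced-transversal (suc n) (false ∷ Q) F lt
  with totalWeight (Q ∷ʳ true) (unmet true F) <? 4 ^ n
     | totalWeight (Q ∷ʳ false) (unmet false F) <? 4 ^ n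
... | yes lt₁ | _ with C , paced , ms ← paced-transversal n (Q ∷ʳ true) (unmet true F) lt₁ =
  true ∷ C , (refl , paced) , unmet-all true C F ms
... | no _ | yes lt₀ with C , paced , ms ← paced-transversal n (Q ∷ʳ false) (unmet false F) lt₀ =
  false ∷ C , (refl , paced) , unmet-all false C F ms
... | no ge₁ | no ge₀ = ⊥-elim (<⇒≱ lt (begin
  4 * 4 ^ n         ≡⟨ eq (4 ^ n) ⟩
  2 * (4 ^ n + 4 ^ n) ≤⟨ *-monoʳ-≤ 2 (+-mono-≤ (≮⇒≥ ge₁) (≮⇒≥ ge₀)) ⟩
  _                 ≤⟨ free-step Q F ⟩
  totalWeight (false ∷ Q) F ∎))
  where
  open ≤-Reasoning
  eq : ∀ x → 4 * x ≡ 2 * (x + x)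
  eq = solve-∀

totalWeight-empty-queue : ∀ m {n} M (F : List (Subset n)) → All (λ S → ∣ S ∣ ≡ M) F →
  totalWeight (replicate m false) F * 4 ^ M ≤ length F * 3 ^ M * 4 ^ n
totalWeight-empty-queue m     M []      []          = z≤n
totalWeight-empty-queue m {n} M (S ∷ F) (refl ∷ eqs) = begin
  (weight Q S + totalWeight Q F) * 4 ^ M          ≡⟨ *-distribʳ-+ (4 ^ M) (weight Q S) _ ⟩
  weight Q S * 4 ^ M + totalWeight Q F * 4 ^ M    ≤⟨ +-mono-≤ (weight-empty-queue m S) (totalWeight-empty-queue m M F eqs) ⟩
  3 ^ M * 4 ^ n + length F * 3 ^ M * 4 ^ n        ≡⟨ *-distribʳ-+ (4 ^ n) (3 ^ M) _ ⟨
  (3 ^ M + length F * 3 ^ M) * 4 ^ n              ∎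
  where
  open ≤-Reasoning
  Q : Vec Bool m
  Q = replicate m false

-- The inequality is a union bound: the expected number of missed sets is below 1. The queue starts
-- all `false` because no point precedes the first.
free-transversal : ∀ {n} e M (F : List (Subset n)) → All (λ S → ∣ S ∣ ≡ M) F →
  length F * 3 ^ M < 4 ^ M → ∃[ C ] Free (suc e) C × All (Meets C) F
free-transversal {n} e M F eqs lt
  with C , paced , ms ← paced-transversal n (replicate (suc e) false) F
         (*-cancelʳ-< _ _ _ (≤-<-trans (totalWeight-empty-queue (suc e) M F eqs)
           (<-≤-trans (*-monoˡ-< (4 ^ n) {{m^n≢0 4 n}} lt) (≤-reflexive (*-comm (4 ^ M) (4 ^ n)))))) =
  C , shift-free⇒Free C e (Paced-shift-free _ C paced) , ms

x∈p─q⇒x∉q : ∀ {n} (p q : Subset n) {x} → x ∈ p ─ q → x ∈ q → ⊥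
x∈p─q⇒x∉q (_ ∷ p) (_ ∷ q) (there x∈) (there x∈q) = x∈p─q⇒x∉q p q x∈ x∈q
x∈p─q⇒x∉q (a ∷ p) (true ∷ q) () here

claimer-wins : ∀ n k → n ^ suc k * 3 ^ (2 ^ k) < 4 ^ (2 ^ k) → ClaimerWinsWithin n (suc k)
claimer-wins n k lt = reply opening
  where
  F : List (Subset n)
  -- Small cubes might be missed too often, but `greedy-wins` only requires cubes of full size to be
  -- destroyed.
  F = filter (λ S → ∣ S ∣ ≟ 2 ^ k) (cubes n k)

  ∣F∣≤ : length F ≤ n ^ suc k
  ∣F∣≤ = ≤-trans (length-filter (λ S → ∣ S ∣ ≟ 2 ^ k) (cubes n k)) (length-cubes n k)

  opening : (d : Distance n) → ∃[ C ] C ⊆ ⊤ × Free (distance d) C × Strategy k (⊤ ─ C)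
  opening d
    with C , free , ms ← free-transversal (toℕ d) (2 ^ k) F
           (all-filter (λ S → ∣ S ∣ ≟ 2 ^ k) (cubes n k))
           (≤-<-trans (*-monoˡ-≤ (3 ^ (2 ^ k)) ∣F∣≤) lt) =
    C , (λ _ → ∈⊤) , free , greedy-wins k (⊤ ─ C) λ W W∈ ∣W∣ W⊆ →
      let x , x∈C , x∈W = All.lookup ms (∈-filter⁺ (λ S → ∣ S ∣ ≟ 2 ^ k) W∈ ∣W∣)
      in x∈p─q⇒x∉q ⊤ C (W⊆ x∈W) x∈C

-- Namer's strategy

⟦_⟧ : Bool → ℕ
⟦ b ⟧ = if b then 1 else 0

∣∷∣ : ∀ {n} a (A : Subset n) → ∣ a ∷ A ∣ ≡ ⟦ a ⟧ + ∣ A ∣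
∣∷∣ true  A = refl
∣∷∣ false A = refl

-- Pairs at distance `e + 1`, counted at their smaller point: index `e` of the tail is `e + 1`
-- beyond the head.
pairs : ∀ {n} → ℕ → Subset n → ℕ
pairs e []      = 0
pairs e (a ∷ A) = ⟦ a ∧ A ! e ⟧ + pairs e A

countFrom : ∀ {n} → ℕ → Subset n → ℕ
countFrom j       []      = 0
countFrom zero    A       = ∣ A ∣
countFrom (suc j) (a ∷ A) = countFrom j A

countFrom-≤ : ∀ {n} j (A : Subset n) → countFrom j A ≤ ∣ A ∣
countFrom-≤ j       []          = z≤n
countFrom-≤ zero    (a ∷ A)     = ≤-refl
countFrom-≤ (suc j) (true  ∷ A) = m≤n⇒m≤1+n (countFrom-≤ j A)
countFrom-≤ (suc j) (false ∷ A) = countFrom-≤ j A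

countFrom-! : ∀ {n} j (A : Subset n) → ⟦ A ! j ⟧ + countFrom (suc j) A ≡ countFrom j A
countFrom-! j       []          = refl
countFrom-! zero    (a ∷ [])    = sym (∣∷∣ a [])
countFrom-! zero    (a ∷ b ∷ A) = sym (∣∷∣ a (b ∷ A))
countFrom-! (suc j) (a ∷ A)     = countFrom-! j A

∧-≤-+ : ∀ a b c d → (a ≡ true → b ≡ true → c ≡ true ⊎ d ≡ true) → ⟦ a ∧ b ⟧ ≤ ⟦ c ⟧ + ⟦ d ⟧
∧-≤-+ false b     c d h = z≤n
∧-≤-+ true  false c d h = z≤n
∧-≤-+ true  true  c d h with h refl refl
... | inj₁ refl = s≤s z≤n
... | inj₂ refl = m≤n+m 1 ⟦ c ⟧

-- Charge each pair to an endpoint in `B`. A point is charged at most once as lower end and once as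
-- upper end, and upper ends have index at least `e + 1`.
pairs-cover : ∀ {n} e (A B : Subset n) →
  (∀ j → A ! j ≡ true → A ! (j + suc e) ≡ true → B ! j ≡ true ⊎ B ! (j + suc e) ≡ true) →
  pairs e A ≤ ∣ B ∣ + countFrom (suc e) B
pairs-cover e []      []      h = z≤n
pairs-cover e (a ∷ A) (b ∷ B) h = begin
  ⟦ a ∧ A ! e ⟧ + pairs e A                          ≤⟨ +-mono-≤ (∧-≤-+ a (A ! e) b (B ! e) (h 0)) (pairs-cover e A B (h ∘ suc)) ⟩
  ⟦ b ⟧ + ⟦ B ! e ⟧ + (∣ B ∣ + countFrom (suc e) B)  ≡⟨ eq ⟦ b ⟧ ⟦ B ! e ⟧ ∣ B ∣ _ ⟩
  ⟦ b ⟧ + ∣ B ∣ + (⟦ B ! e ⟧ + countFrom (suc e) B)  ≡⟨ cong₂ _+_ (sym (∣∷∣ b B)) (countFrom-! e B) ⟩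
  ∣ b ∷ B ∣ + countFrom e B                          ∎
  where
  open ≤-Reasoning
  eq : ∀ p q r s → p + q + (r + s) ≡ p + r + (q + s)
  eq = solve-∀

pairs-─-free : ∀ {n} e (A C : Subset n) → Free (suc e) C → pairs e A ≤ 2 * ∣ A ─ C ∣
pairs-─-free e A C free = begin
  pairs e A                               ≤⟨ pairs-cover e A (A ─ C) unclaimed ⟩
  ∣ A ─ C ∣ + countFrom (suc e) (A ─ C)   ≤⟨ +-monoʳ-≤ _ (countFrom-≤ (suc e) (A ─ C)) ⟩
  ∣ A ─ C ∣ + ∣ A ─ C ∣                   ≡⟨ cong (∣ A ─ C ∣ +_) (+-identityʳ _) ⟨
  2 * ∣ A ─ C ∣                           ∎
  where
  open ≤-Reasoning
  unclaimed : ∀ j → A ! j ≡ true → A ! (j + suc e) ≡ true →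
              (A ─ C) ! j ≡ true ⊎ (A ─ C) ! (j + suc e) ≡ true
  unclaimed j p q with C ! j in eq | C ! (j + suc e) in eq′
  ... | false | _     = inj₁ (!-─ A C j p eq)
  ... | true  | false = inj₂ (!-─ A C _ q eq′)
  ... | true  | true  = ⊥-elim (Free⇒shift-free C e free j eq eq′)

∣∣≤∑! : ∀ {n} N (A : Subset n) → n ≤ N → ∣ A ∣ ≤ Fin∑.sum {N} (λ d → ⟦ A ! toℕ d ⟧)
∣∣≤∑! N       []      n≤N       = z≤n
∣∣≤∑! (suc N) (a ∷ A) (s≤s n≤N) =
  ≤-trans (≤-reflexive (∣∷∣ a A)) (+-monoʳ-≤ ⟦ a ⟧ (∣∣≤∑! N A n≤N))

-- Induction on the least point: a new head forms a pair with each of the other points, and the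
-- distances below `suc N` reach all of them.
∣∣²≤ : ∀ {n} N (A : Subset n) → n ≤ suc N →
       ∣ A ∣ * ∣ A ∣ ≤ ∣ A ∣ + 2 * Fin∑.sum {N} (λ d → pairs (toℕ d) A)
∣∣²≤ N []          n≤N       = z≤n
∣∣²≤ N (false ∷ A) (s≤s n≤N) = ∣∣²≤ N A (m≤n⇒m≤1+n n≤N)
∣∣²≤ N (true ∷ A)  (s≤s n≤N) = begin
  suc m * suc m                      ≡⟨ eq m ⟩
  1 + m + (m + m * m)                ≤⟨ +-monoʳ-≤ (1 + m) (+-monoʳ-≤ m (∣∣²≤ N A (m≤n⇒m≤1+n n≤N))) ⟩
  1 + m + (m + (m + 2 * P))          ≡⟨ eq′ m P ⟩
  1 + m + 2 * (m + P)                ≤⟨ +-monoʳ-≤ (1 + m) (*-monoʳ-≤ 2 (+-monoˡ-≤ P (∣∣≤∑! N A n≤N))) ⟩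
  1 + m + 2 * (Fin∑.sum {N} (λ d → ⟦ A ! toℕ d ⟧) + P) ≡⟨ cong (λ s → 1 + m + 2 * s) (Fin∑.∑-distrib-+ {N} _ _) ⟨
  1 + m + 2 * Fin∑.sum {N} (λ d → ⟦ A ! toℕ d ⟧ + pairs (toℕ d) A) ∎
  where
  open ≤-Reasoning
  m P : ℕ
  m = ∣ A ∣
  P = Fin∑.sum {N} (λ d → pairs (toℕ d) A)
  eq : ∀ m → suc m * suc m ≡ 1 + m + (m + m * m)
  eq = solve-∀
  eq′ : ∀ m p → 1 + m + (m + (m + 2 * p)) ≡ 1 + m + 2 * (m + p)
  eq′ = solve-∀

∃-above-average : ∀ N (f : Fin (suc N) → ℕ) → ∃[ d ] Fin∑.sum f ≤ suc N * f d
∃-above-average zero    f = zero , ≤-refl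
∃-above-average (suc N) f with d , avg ← ∃-above-average N (f ∘ suc) | ≤-total (f zero) (f (suc d))
... | inj₁ f₀≤ = suc d , +-mono-≤ f₀≤ avg
... | inj₂ f₀≥ = zero , +-monoʳ-≤ (f zero) (≤-trans avg (*-monoʳ-≤ (suc N) f₀≥))

-- Averaging over the distances. Since `2 ≤ ∣ A ∣`, the linear term of `∣∣²≤` is at most half the
-- square; this gives a factor 4, and the hypothesis on `B` doubles it to 8.
dense-distance : ∀ {n} (A : Subset n) (B : Distance n → Subset n) → 2 ≤ ∣ A ∣ →
  (∀ d → pairs (toℕ d) A ≤ 2 * ∣ B d ∣) → ∃[ d ] ∣ A ∣ * ∣ A ∣ ≤ 8 * n * ∣ B d ∣
dense-distance {zero}        []          B ()
dense-distance {suc zero}    A           B 2≤ h = ⊥-elim (<⇒≱ (s≤s (s≤s z≤n)) (≤-trans 2≤ (∣p∣≤n A)))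
dense-distance {suc (suc n)} A           B 2≤ h
  with d , avg ← ∃-above-average n (λ d → pairs (toℕ d) A) = d , +-cancelʳ-≤ (m * m) _ _ (begin
    m * m + m * m             ≤⟨ +-mono-≤ (∣∣²≤ (suc n) A ≤-refl) (∣∣²≤ (suc n) A ≤-refl) ⟩
    (m + 2 * P) + (m + 2 * P) ≡⟨ eq m P ⟩
    4 * P + 2 * m             ≤⟨ +-mono-≤ (*-monoʳ-≤ 4 (≤-trans avg (*-monoʳ-≤ (suc n) (h d)))) (*-monoˡ-≤ m 2≤) ⟩
    4 * (suc n * (2 * b d)) + m * m ≤⟨ +-monoˡ-≤ (m * m) (*-monoʳ-≤ 4 (*-monoˡ-≤ (2 * b d) (n≤1+n (suc n)))) ⟩
    4 * (suc (suc n) * (2 * b d)) + m * m ≡⟨ cong (_+ m * m) (eq′ (suc (suc n)) (b d)) ⟩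
    8 * suc (suc n) * b d + m * m ∎)
  where
  open ≤-Reasoning
  m P : ℕ
  m = ∣ A ∣
  P = Fin∑.sum {suc n} (λ d → pairs (toℕ d) A)
  b : Fin (suc n) → ℕ
  b d = ∣ B d ∣
  eq : ∀ m p → (m + 2 * p) + (m + 2 * p) ≡ 4 * p + 2 * m
  eq = solve-∀
  eq′ : ∀ n b → 4 * (n * (2 * b)) ≡ 8 * n * b
  eq′ = solve-∀

-- Decay of the density over the rounds

^-distribʳ-* : ∀ m n k → (m * n) ^ k ≡ m ^ k * n ^ k
^-distribʳ-* m n zero    = refl
^-distribʳ-* m n (suc k) =
  trans (cong (m * n *_) (^-distribʳ-* m n k)) (eq m n (m ^ k) (n ^ k))
  where
  eq : ∀ m n p q → m * n * (p * q) ≡ m * p * (n * q)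
  eq = solve-∀

^-cancelˡ-≤ : ∀ {m n} k .{{_ : NonZero k}} → m ^ k ≤ n ^ k → m ≤ n
^-cancelˡ-≤ k le = ≮⇒≥ λ n<m → <⇒≱ (^-monoˡ-< k n<m) le

^-double : ∀ m k → m ^ (2 ^ suc k) ≡ (m * m) ^ (2 ^ k)
^-double m k = trans (sym (^-*-assoc m 2 (2 ^ k))) (cong (λ x → (m * x) ^ (2 ^ k)) (*-identityʳ m))

-- Covers the positions with fewer than two points, where `dense-distance` does not apply.
small-bound : ∀ {n} k (A : Subset n) → ∣ A ∣ ≤ 1 → ∣ A ∣ ^ (2 ^ k) * (8 * n) ≤ (8 * n) ^ (2 ^ k)
small-bound {zero}  k []          _  = ≤-trans (≤-reflexive (*-zeroʳ (0 ^ (2 ^ k)))) z≤n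
small-bound {suc n} k A           le = begin
  ∣ A ∣ ^ (2 ^ k) * (8 * suc n) ≤⟨ *-monoˡ-≤ (8 * suc n) (^-monoˡ-≤ (2 ^ k) le) ⟩
  1 ^ (2 ^ k) * (8 * suc n)     ≡⟨ cong (_* (8 * suc n)) (^-zeroˡ (2 ^ k)) ⟩
  1 * (8 * suc n)               ≡⟨ *-identityˡ (8 * suc n) ⟩
  8 * suc n                     ≡⟨ ^-identityʳ (8 * suc n) ⟨
  (8 * suc n) ^ 1               ≤⟨ ^-monoʳ-≤ (8 * suc n) (m^n>0 2 k) ⟩
  (8 * suc n) ^ (2 ^ k)         ∎
  where open ≤-Reasoning

-- Normalise the density as `∣ A ∣` divided by `8 * n`. Then `dense-distance` says that some
-- distance leaves at least the square of the density, so `k` rounds raise it at worst to the power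
-- `2 ^ k`; the bound says that this power is at most `1 / (8 * n)`.
strategy-bound : ∀ {n} k (A : Subset n) → Strategy k A →
                 ∣ A ∣ ^ (2 ^ k) * (8 * n) ≤ (8 * n) ^ (2 ^ k)
strategy-bound {n} k A (over empty) = small-bound k A
  (≤-trans (≤-reflexive (trans (cong ∣_∣ (Empty-unique empty)) (∣⊥∣≡0 n))) z≤n)
strategy-bound {n} (suc k) A (reply r) with 2 ≤? ∣ A ∣
... | no  ∣A∣≱2 = small-bound (suc k) A (s≤s⁻¹ (≰⇒> ∣A∣≱2))
... | yes ∣A∣≥2
  with d , dense ← dense-distance A (λ d → A ─ proj₁ (r d)) ∣A∣≥2
         (λ d → pairs-─-free (toℕ d) A (proj₁ (r d)) (proj₁ (proj₂ (proj₂ (r d))))) = begin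
  m ^ (2 ^ suc k) * X           ≡⟨ cong (_* X) (^-double m k) ⟩
  (m * m) ^ (2 ^ k) * X         ≤⟨ *-monoˡ-≤ X (^-monoˡ-≤ (2 ^ k) dense) ⟩
  (X * m′ d) ^ (2 ^ k) * X      ≡⟨ cong (_* X) (^-distribʳ-* X (m′ d) (2 ^ k)) ⟩
  X ^ (2 ^ k) * m′ d ^ (2 ^ k) * X   ≡⟨ *-assoc (X ^ (2 ^ k)) _ X ⟩
  X ^ (2 ^ k) * (m′ d ^ (2 ^ k) * X) ≤⟨ *-monoʳ-≤ (X ^ (2 ^ k)) (strategy-bound k _ (proj₂ (proj₂ (proj₂ (r d))))) ⟩
  X ^ (2 ^ k) * X ^ (2 ^ k)     ≡⟨ ^-distribʳ-* X X (2 ^ k) ⟨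
  (X * X) ^ (2 ^ k)             ≡⟨ ^-double X k ⟨
  X ^ (2 ^ suc k)               ∎
  where
  open ≤-Reasoning
  m X : ℕ
  m = ∣ A ∣
  X = 8 * n
  m′ : Distance n → ℕ
  m′ d = ∣ A ─ proj₁ (r d) ∣

-- The two bounds

-- Apply `strategy-bound` to the full set and cancel `n ^ (2 ^ k)`. Weakening the exponent
-- `3 * 2 ^ k` to `2 ^ (k * 3)` leaves a pure multiple of `k`, without an additive constant.
n≤2^2^3k : ∀ n k → 2 ≤ n → ClaimerWinsWithin n k → n ≤ 2 ^ (2 ^ (k * 3))
n≤2^2^3k n@(suc _) k 2≤n wins = go k 8n≤
  where
  open ≤-Reasoning
  instance
    n^≢0 : NonZero (n ^ (2 ^ k))
    n^≢0 = m^n≢0 n (2 ^ k)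
  8n≤ : 8 * n ≤ 8 ^ (2 ^ k)
  8n≤ = *-cancelˡ-≤ (n ^ (2 ^ k)) (begin
    n ^ (2 ^ k) * (8 * n)              ≡⟨ cong (λ m → m ^ (2 ^ k) * (8 * n)) (∣⊤∣≡n n) ⟨
    ∣ ⊤ {n} ∣ ^ (2 ^ k) * (8 * n)      ≤⟨ strategy-bound k ⊤ wins ⟩
    (8 * n) ^ (2 ^ k)                  ≡⟨ ^-distribʳ-* 8 n (2 ^ k) ⟩
    8 ^ (2 ^ k) * n ^ (2 ^ k)          ≡⟨ *-comm (8 ^ (2 ^ k)) _ ⟩
    n ^ (2 ^ k) * 8 ^ (2 ^ k)          ∎)
  -- False for exponent 0, which is why `go` treats that case directly through `8 * n ≤ 8`.
  3*2^≤ : ∀ k → 3 * 2 ^ suc k ≤ 2 ^ (suc k * 3)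
  3*2^≤ zero    = m≤m+n 6 2
  3*2^≤ (suc k) = begin
    3 * (2 * 2 ^ suc k)   ≡⟨ eq (2 ^ suc k) ⟩
    2 * (3 * 2 ^ suc k)   ≤⟨ *-mono-≤ (m≤m+n 2 6) (3*2^≤ k) ⟩
    8 * 2 ^ (suc k * 3)   ≡⟨ ^-distribˡ-+-* 2 3 (suc k * 3) ⟨
    2 ^ (3 + suc k * 3)   ∎
    where
    eq : ∀ x → 3 * (2 * x) ≡ 2 * (3 * x)
    eq = solve-∀
  go : ∀ k → 8 * n ≤ 8 ^ (2 ^ k) → n ≤ 2 ^ (2 ^ (k * 3))
  go zero    le = ≤-trans (*-cancelˡ-≤ {n} {1} 8 le) (n≤1+n 1)
  go (suc k) le = begin
    n                    ≤⟨ m≤m+n n (7 * n) ⟩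
    8 * n                ≤⟨ le ⟩
    8 ^ (2 ^ suc k)      ≡⟨ ^-*-assoc 2 3 (2 ^ suc k) ⟩
    2 ^ (3 * 2 ^ suc k)  ≤⟨ ^-monoʳ-≤ 2 (3*2^≤ k) ⟩
    2 ^ (2 ^ (suc k * 3)) ∎

-- Rounds sufficient for Claimer

n<2^n : ∀ n → suc n ≤ 2 ^ n
n<2^n zero    = ≤-refl
n<2^n (suc n) = ≤-trans (+-mono-≤ (m^n>0 2 n) (n<2^n n)) (≤-reflexive (cong (2 ^ n +_) (sym (+-identityʳ _))))

log-bounds : ∀ n → 1 ≤ n → ∃[ l ] 2 ^ l ≤ n × n < 2 ^ suc l
log-bounds (suc zero)      _ = 0 , ≤-refl , ≤-refl
log-bounds (suc n@(suc _)) _ with l , lo , hi ← log-bounds n (s≤s z≤n) | suc n <? 2 ^ suc l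
... | yes hi′ = l , m≤n⇒m≤1+n lo , hi′
... | no  ≮   = suc l , ≮⇒≥ ≮ ,
  ≤-<-trans hi (^-monoʳ-< 2 ≤-refl (n<1+n (suc l)))

-- Three points of a cube pay for one factor 2 in the number of cubes, because 2 * 27 = 54 is below
-- 64.
cube-count : ∀ n k N → n ^ suc k < 2 ^ N → 3 * N ≤ 2 ^ k → n ^ suc k * 3 ^ (2 ^ k) < 4 ^ (2 ^ k)
cube-count n k N lt le = begin-strict
  n ^ suc k * 3 ^ (2 ^ k)              <⟨ *-monoˡ-< (3 ^ (2 ^ k)) {{m^n≢0 3 (2 ^ k)}} lt ⟩
  2 ^ N * 3 ^ (2 ^ k)                  ≡⟨ cong (λ e → 2 ^ N * 3 ^ e) split ⟨
  2 ^ N * 3 ^ (3 * N + R)              ≡⟨ cong (2 ^ N *_) (^-distribˡ-+-* 3 (3 * N) R) ⟩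
  2 ^ N * (3 ^ (3 * N) * 3 ^ R)        ≡⟨ *-assoc (2 ^ N) _ _ ⟨
  2 ^ N * 3 ^ (3 * N) * 3 ^ R          ≡⟨ cong (λ x → 2 ^ N * x * 3 ^ R) (^-*-assoc 3 3 N) ⟨
  2 ^ N * 27 ^ N * 3 ^ R               ≡⟨ cong (_* 3 ^ R) (^-distribʳ-* 2 27 N) ⟨
  54 ^ N * 3 ^ R                       ≤⟨ *-mono-≤ (^-monoˡ-≤ N (m≤m+n 54 10)) (^-monoˡ-≤ R (n≤1+n 3)) ⟩
  64 ^ N * 4 ^ R                       ≡⟨ cong (_* 4 ^ R) (^-*-assoc 4 3 N) ⟩
  4 ^ (3 * N) * 4 ^ R                  ≡⟨ ^-distribˡ-+-* 4 (3 * N) R ⟨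
  4 ^ (3 * N + R)                      ≡⟨ cong (4 ^_) split ⟩
  4 ^ (2 ^ k)                          ∎
  where
  open ≤-Reasoning
  R : ℕ
  R = 2 ^ k ∸ 3 * N
  split : 3 * N + R ≡ 2 ^ k
  split = m+[n∸m]≡n le

-- With `k = 6 + 2 * j`, one factor `2 ^ j` of `2 ^ k` pays for the logarithm of `n`, the other for
-- the number `k + 1` of parameters of a cube, and `2 ^ 6` for the constant 42.
claimer-wins-loglog : ∀ n j → n < 2 ^ (2 ^ suc j) → ClaimerWinsWithin n (7 + 2 * j)
claimer-wins-loglog n j lt =
  claimer-wins n (6 + 2 * j) (cube-count n (6 + 2 * j) (2 ^ suc j * (7 + 2 * j))
  (<-≤-trans (^-monoˡ-< (7 + 2 * j) lt) (≤-reflexive (^-*-assoc 2 (2 ^ suc j) (7 + 2 * j)))) (begin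
    3 * (2 ^ suc j * (7 + 2 * j))         ≤⟨ *-monoʳ-≤ 3 (*-monoʳ-≤ (2 ^ suc j) linear) ⟩
    3 * (2 ^ suc j * (7 * 2 ^ j))         ≡⟨ eq (2 ^ j) ⟩
    42 * (2 ^ j * 2 ^ j)                  ≤⟨ *-monoˡ-≤ (2 ^ j * 2 ^ j) (m≤m+n 42 22) ⟩
    64 * (2 ^ j * 2 ^ j)                  ≡⟨ cong (64 *_) (trans (cong (2 ^_) (cong (j +_) (+-identityʳ j))) (^-distribˡ-+-* 2 j j)) ⟨
    64 * 2 ^ (2 * j)                      ≡⟨ ^-distribˡ-+-* 2 6 (2 * j) ⟨
    2 ^ (6 + 2 * j)                       ∎))
  where
  open ≤-Reasoning
  linear : 7 + 2 * j ≤ 7 * 2 ^ j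
  linear = begin
    7 + 2 * j   ≤⟨ +-monoʳ-≤ 7 (*-monoˡ-≤ j (m≤m+n 2 5)) ⟩
    7 + 7 * j   ≡⟨ *-suc 7 j ⟨
    7 * suc j   ≤⟨ *-monoʳ-≤ 7 (n<2^n j) ⟩
    7 * 2 ^ j   ∎
  eq : ∀ x → 3 * (2 * x * (7 * x)) ≡ 42 * (x * x)
  eq = solve-∀

2≤exponent : ∀ {n} l → 4 ≤ n → n < 2 ^ suc l → 2 ≤ l
2≤exponent zero          4≤n hi = ⊥-elim (<⇒≱ hi (≤-trans (m≤m+n 2 2) 4≤n))
2≤exponent (suc zero)    4≤n hi = ⊥-elim (<⇒≱ hi 4≤n)
2≤exponent (suc (suc l)) 4≤n hi = s≤s (s≤s z≤n)

2^L≤l^9 : ∀ n → 4 ≤ n → ∃[ l ] 2 ^ l ≤ n × 2 ^ L n ≤ l ^ 9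
2^L≤l^9 n 4≤n
  with l , lo , hi ← log-bounds n (≤-trans (s≤s z≤n) 4≤n)
  with j , lo′ , hi′ ← log-bounds l (<⇒≤ (2≤exponent l 4≤n hi)) = l , lo , (begin
    2 ^ L n                 ≤⟨ ^-monoʳ-≤ 2 (proj₂ (L-isLeast n) _ (claimer-wins-loglog n j (<-≤-trans hi (^-monoʳ-≤ 2 hi′)))) ⟩
    2 ^ (7 + 2 * j)         ≡⟨ ^-distribˡ-+-* 2 7 (2 * j) ⟩
    2 ^ 7 * 2 ^ (2 * j)     ≡⟨ cong (λ e → 2 ^ 7 * 2 ^ e) (*-comm 2 j) ⟩
    2 ^ 7 * 2 ^ (j * 2)     ≡⟨ cong (2 ^ 7 *_) (^-*-assoc 2 j 2) ⟨
    -- The exponent 9 is 7 + 2: `2 ≤ l` absorbs the additive 7, and `2 ^ j ≤ l` the term `2 * j`.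
    2 ^ 7 * (2 ^ j) ^ 2     ≤⟨ *-mono-≤ (^-monoˡ-≤ 7 (2≤exponent l 4≤n hi)) (^-monoˡ-≤ 2 lo′) ⟩
    l ^ 7 * l ^ 2           ≡⟨ ^-distribˡ-+-* l 7 2 ⟨
    l ^ 9                   ∎)
  where
  open ≤-Reasoning

-- Comparisons with the iterated logarithm

-- Here `a / b` is any fraction above `2 ^ m`, and `a′ / b′` any fraction above 2 to the power
-- `a / b`, hence above `n`.
log₂log₂-upper : ∀ n m → n ≤ 2 ^ (2 ^ m) → Upper (log₂ (log₂ (fromℕ n))) m 1
log₂log₂-upper n m n≤ a b le a′ b′ le′ = ^-cancelˡ-≤ b (begin
  (n * b′) ^ b                ≡⟨ ^-distribʳ-* n b′ b ⟩
  n ^ b * b′ ^ b              ≤⟨ *-monoˡ-≤ (b′ ^ b) (^-monoˡ-≤ b n≤) ⟩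
  (2 ^ (2 ^ m)) ^ b * b′ ^ b  ≡⟨ cong (_* b′ ^ b) (^-*-assoc 2 (2 ^ m) b) ⟩
  2 ^ (2 ^ m * b) * b′ ^ b    ≤⟨ *-monoˡ-≤ (b′ ^ b) (^-monoʳ-≤ 2 2^m*b≤a) ⟩
  2 ^ a * b′ ^ b              ≤⟨ le′ ⟩
  a′ ^ b                      ∎)
  where
  open ≤-Reasoning
  2^m*b≤a : 2 ^ m * b ≤ a
  2^m*b≤a = begin
    2 ^ m * b      ≡⟨ cong (2 ^ m *_) (*-identityʳ b) ⟨
    2 ^ m * b ^ 1  ≤⟨ le ⟩
    a ^ 1          ≡⟨ *-identityʳ a ⟩
    a              ∎

-- The integer `l` separates the two logarithms: `a / b` lies below 2 to the power `m / q`, hence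
-- below `l`, and so `a′ / b′` lies below `2 ^ l`.
log₂log₂-lower : ∀ n l m q .{{_ : NonZero q}} → 2 ^ l ≤ n → 2 ^ m ≤ l ^ q →
                 Lower (log₂ (log₂ (fromℕ n))) m q
log₂log₂-lower n l m q 2^l≤n 2^m≤l^q a b le a′ b′ le′ = ^-cancelˡ-≤ b (begin
  a′ ^ b                ≤⟨ le′ ⟩
  2 ^ a * b′ ^ b        ≤⟨ *-monoˡ-≤ (b′ ^ b) (^-monoʳ-≤ 2 a≤l*b) ⟩
  2 ^ (l * b) * b′ ^ b  ≡⟨ cong (_* b′ ^ b) (^-*-assoc 2 l b) ⟨
  (2 ^ l) ^ b * b′ ^ b  ≤⟨ *-monoˡ-≤ (b′ ^ b) (^-monoˡ-≤ b 2^l≤n) ⟩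
  n ^ b * b′ ^ b        ≡⟨ ^-distribʳ-* n b′ b ⟨
  (n * b′) ^ b          ∎)
  where
  open ≤-Reasoning
  a≤l*b : a ≤ l * b
  a≤l*b = ^-cancelˡ-≤ q (begin
    a ^ q          ≤⟨ le ⟩
    2 ^ m * b ^ q  ≤⟨ *-monoˡ-≤ (b ^ q) 2^m≤l^q ⟩
    l ^ q * b ^ q  ≡⟨ ^-distribʳ-* l b q ⟨
    (l * b) ^ q    ∎)

theorem1 : Σ[ c ∈ ℚ⁺ ] Σ[ C ∈ ℚ⁺ ] Σ[ n₀ ∈ ℕ ]
    (∀ (n : ℕ) → n₀ ≤ n →
    (c · log₂ (log₂ (fromℕ n)) ≤ℕ L n) × (L n ℕ≤ C · log₂ (log₂ (fromℕ n))))
-- The constant 1/3 comes from the exponent in `n≤2^2^3k`, 9 from `2^L≤l^9`, and the threshold 4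
-- makes the integer logarithm of `n` at least 2.
theorem1 = mkℚ⁺ 1 3 , mkℚ⁺ 9 1 , 4 , λ n 4≤n →
  log₂log₂-upper n (L n * 3)
    (n≤2^2^3k n (L n) (≤-trans (m≤m+n 2 2) 4≤n) (proj₁ (L-isLeast n))) ,
  (let l , 2^l≤n , 2^L≤ = 2^L≤l^9 n 4≤n
   in log₂log₂-lower n l (L n * 1) 9 2^l≤n
        (subst (λ m → 2 ^ m ≤ l ^ 9) (sym (*-identityʳ (L n))) 2^L≤))
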